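{- Let $d,N\in\mathbb{N}$, $0<\alpha<1$, $0<\beta<1$, and let $\{S_i\}_{i=1}^N$ be a family of $(\alpha,\beta(\alpha\beta)^{N-1})$-winning sets of $\mathbb{R}^d$. Then $\bigcap_{i=1}^N S_i$ is an $(\alpha,\beta)$-winning set of $\mathbb{R}^d$.
   Context: Fix a norm on $\mathbb{R}^d$; closed balls are taken in this norm. Schmidt game: for a closed ball $B$ (positive radius, radius denoted $\rho(B)$) and $0<\gamma\le 1$, let $B^\gamma$ be the collection of closed balls $\widetilde B\subset B$ with $\rho(\widetilde B)=\gamma\rho(B)$. For $S\subset\mathbb{R}^d$ and $0<\alpha,\beta<1$, in the $(\alpha,\beta;S)$-game Bob chooses an arbitrary closed ball $B_1$, and then, for $n\ge1$, Alice chooses $A_n\in B_n^\alpha$ and Bob chooses $B_{n+1}\in A_n^\beta$. The intersection $\bigcap_{n} B_n$ is a single point. $S$ is an $(\alpha,\beta)$-winning set of $\mathbb{R}^d$ if Alice has a strategy ensuring, whatever Bob plays (including $B_1$), that this point lies in $S$. -}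

module Defs where

open import Data.Fin.Base using (Fin; toℕ; fromℕ; inject₁) renaming (suc to fsuc)
open import Data.Fin.Properties using (toℕ-inject₁)
open import Data.Nat.Base as ℕ using (ℕ; zero; suc)
import Data.Nat.Properties as ℕ
open import Data.Product.Base using (Σ-syntax; ∃; _×_; _,_)
open import Data.Rational.Base as ℚ using (ℚ; 0ℚ; 1ℚ; ½)
import Data.Rational.Properties as ℚ
open import Data.Rational.Solver using (module +-*-Solver)
open import Data.Sum.Base using (inj₁; inj₂)
open import Data.Vec.Functional using (Vector; map; zipWith; replicate)
open import Data.Vec.Functional.Relation.Binary.Pointwise using (Pointwise)
open import Function.Base using (_∘_)
open import Level using (0ℓ)
open import Relation.Binary.PropositionalEquality
  using (_≡_; refl; sym; cong; cong₂; subst)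
open import Relation.Unary using (Pred; _∈_; _⊆_)

------------------------------------------------------------------------
-- Real numbers: Cauchy sequences of rationals, taken up to null sequences.

Eventually : Pred ℕ 0ℓ → Set
Eventually P = ∃ λ N → ∀ n → N ℕ.≤ n → P n

IsCauchy : (ℕ → ℚ) → Set
IsCauchy s = ∀ ε → 0ℚ ℚ.< ε →
  ∃ λ N → ∀ m n → N ℕ.≤ m → N ℕ.≤ n → ℚ.∣ s m ℚ.- s n ∣ ℚ.< ε

record ℝ : Set where
  constructor mkℝ
  field
    seq    : ℕ → ℚ
    cauchy : IsCauchy seq

open ℝ public

infix  4 _≈_ _≤_ _<_

_≈_ : ℝ → ℝ → Set
x ≈ y = ∀ ε → 0ℚ ℚ.< ε → Eventually λ n → ℚ.∣ seq x n ℚ.- seq y n ∣ ℚ.< ε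

_≤_ : ℝ → ℝ → Set
x ≤ y = ∀ ε → 0ℚ ℚ.< ε → Eventually λ n → seq x n ℚ.≤ seq y n ℚ.+ ε

_<_ : ℝ → ℝ → Set
x < y = ∃ λ ε → 0ℚ ℚ.< ε × Eventually λ n → seq x n ℚ.+ ε ℚ.≤ seq y n

-- Abstract because unfolding these proofs makes typechecking intractable; only
-- the underlying sequences of sums, products etc. matter.
abstract

  halve-pos : ∀ ε → 0ℚ ℚ.< ε → 0ℚ ℚ.< ε ℚ.* ½
  halve-pos ε = ℚ.*-monoˡ-<-pos ½

  halves : ∀ ε → ε ℚ.* ½ ℚ.+ ε ℚ.* ½ ≡ ε
  halves = solve 1 (λ e → e :* con ½ :+ e :* con ½ := e) refl
    where open +-*-Solver

  const-cauchy : ∀ q → IsCauchy (λ _ → q)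
  const-cauchy q ε ε>0 = 0 , λ _ _ _ _ →
    subst (ℚ._< ε) (sym (cong ℚ.∣_∣ (ℚ.+-inverseʳ q))) ε>0

  neg-cauchy : ∀ {s} → IsCauchy s → IsCauchy (ℚ.-_ ∘ s)
  neg-cauchy {s} cs ε ε>0 with cs ε ε>0
  ... | N , p = N , λ m n N≤m N≤n → subst (ℚ._< ε) (eq m n) (p m n N≤m N≤n)
    where
    open +-*-Solver
    open Relation.Binary.PropositionalEquality.≡-Reasoning
    eq : ∀ m n → ℚ.∣ s m ℚ.- s n ∣ ≡ ℚ.∣ ℚ.- s m ℚ.- ℚ.- s n ∣
    eq m n = begin
      ℚ.∣ s m ℚ.- s n ∣          ≡⟨ ℚ.∣-p∣≡∣p∣ (s m ℚ.- s n) ⟨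
      ℚ.∣ ℚ.- (s m ℚ.- s n) ∣    ≡⟨ cong ℚ.∣_∣
                                      (solve 2 (λ a b → :- (a :- b) := :- a :- :- b)
                                        refl (s m) (s n)) ⟩
      ℚ.∣ ℚ.- s m ℚ.- ℚ.- s n ∣  ∎

  abs-cauchy : ∀ {s} → IsCauchy s → IsCauchy (ℚ.∣_∣ ∘ s)
  abs-cauchy {s} cs ε ε>0 with cs ε ε>0
  ... | N , p = N , λ m n N≤m N≤n →
    ℚ.≤-<-trans (reverse (s m) (s n)) (p m n N≤m N≤n)
    where
    open +-*-Solver
    open ℚ.≤-Reasoning
    one-sided : ∀ a b → ℚ.∣ a ∣ ℚ.- ℚ.∣ b ∣ ℚ.≤ ℚ.∣ a ℚ.- b ∣
    one-sided a b = begin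
      ℚ.∣ a ∣ ℚ.- ℚ.∣ b ∣
        ≡⟨ cong (λ t → ℚ.∣ t ∣ ℚ.- ℚ.∣ b ∣) (solve 2 (λ a b → a := a :- b :+ b) refl a b) ⟩
      ℚ.∣ a ℚ.- b ℚ.+ b ∣ ℚ.- ℚ.∣ b ∣
        ≤⟨ ℚ.+-monoˡ-≤ (ℚ.- ℚ.∣ b ∣) (ℚ.∣p+q∣≤∣p∣+∣q∣ (a ℚ.- b) b) ⟩
      ℚ.∣ a ℚ.- b ∣ ℚ.+ ℚ.∣ b ∣ ℚ.- ℚ.∣ b ∣
        ≡⟨ solve 2 (λ c d → c :+ d :- d := c) refl ℚ.∣ a ℚ.- b ∣ ℚ.∣ b ∣ ⟩
      ℚ.∣ a ℚ.- b ∣ ∎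
    flip : ∀ a b → ℚ.∣ b ℚ.- a ∣ ≡ ℚ.∣ a ℚ.- b ∣
    flip a b = begin-equality
      ℚ.∣ b ℚ.- a ∣        ≡⟨ ℚ.∣-p∣≡∣p∣ (b ℚ.- a) ⟨
      ℚ.∣ ℚ.- (b ℚ.- a) ∣  ≡⟨ cong ℚ.∣_∣ (solve 2 (λ a b → :- (b :- a) := a :- b) refl a b) ⟩
      ℚ.∣ a ℚ.- b ∣        ∎
    reverse : ∀ a b → ℚ.∣ ℚ.∣ a ∣ ℚ.- ℚ.∣ b ∣ ∣ ℚ.≤ ℚ.∣ a ℚ.- b ∣
    reverse a b with ℚ.∣p∣≡p∨∣p∣≡-p (ℚ.∣ a ∣ ℚ.- ℚ.∣ b ∣)
    ... | inj₁ e = subst (ℚ._≤ ℚ.∣ a ℚ.- b ∣) (sym e) (one-sided a b)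
    ... | inj₂ e = begin
      ℚ.∣ ℚ.∣ a ∣ ℚ.- ℚ.∣ b ∣ ∣     ≡⟨ e ⟩
      ℚ.- (ℚ.∣ a ∣ ℚ.- ℚ.∣ b ∣)     ≡⟨ solve 2 (λ c d → :- (c :- d) := d :- c) refl ℚ.∣ a ∣ ℚ.∣ b ∣ ⟩
      ℚ.∣ b ∣ ℚ.- ℚ.∣ a ∣           ≤⟨ one-sided b a ⟩
      ℚ.∣ b ℚ.- a ∣                 ≡⟨ flip a b ⟩
      ℚ.∣ a ℚ.- b ∣                 ∎

  +-cauchy : ∀ {s t} → IsCauchy s → IsCauchy t → IsCauchy (λ n → s n ℚ.+ t n)
  +-cauchy {s} {t} cs ct ε ε>0
    with cs (ε ℚ.* ½) (halve-pos ε ε>0) | ct (ε ℚ.* ½) (halve-pos ε ε>0)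
  ... | M , p | N , q = M ℕ.⊔ N , λ m n M⊔N≤m M⊔N≤n → begin-strict
    ℚ.∣ s m ℚ.+ t m ℚ.- (s n ℚ.+ t n) ∣
      ≡⟨ cong ℚ.∣_∣ (solve 4 (λ a b c d → a :+ b :- (c :+ d) := a :- c :+ (b :- d))
           refl (s m) (t m) (s n) (t n)) ⟩
    ℚ.∣ s m ℚ.- s n ℚ.+ (t m ℚ.- t n) ∣
      ≤⟨ ℚ.∣p+q∣≤∣p∣+∣q∣ (s m ℚ.- s n) (t m ℚ.- t n) ⟩
    ℚ.∣ s m ℚ.- s n ∣ ℚ.+ ℚ.∣ t m ℚ.- t n ∣
      <⟨ ℚ.+-mono-< (p m n (ℕ.m⊔n≤o⇒m≤o M N M⊔N≤m) (ℕ.m⊔n≤o⇒m≤o M N M⊔N≤n))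
                    (q m n (ℕ.m⊔n≤o⇒n≤o M N M⊔N≤m) (ℕ.m⊔n≤o⇒n≤o M N M⊔N≤n)) ⟩
    ε ℚ.* ½ ℚ.+ ε ℚ.* ½
      ≡⟨ halves ε ⟩
    ε ∎
    where
    open +-*-Solver
    open ℚ.≤-Reasoning

  cauchy-bounded : ∀ {s} → IsCauchy s →
    ∃ λ K → 0ℚ ℚ.< K × Eventually λ n → ℚ.∣ s n ∣ ℚ.≤ K
  cauchy-bounded {s} cs with cs 1ℚ (ℚ.positive⁻¹ 1ℚ)
  ... | N , p = ℚ.∣ s N ∣ ℚ.+ 1ℚ , K>0 , N , λ n N≤n → begin
    ℚ.∣ s n ∣
      ≡⟨ cong ℚ.∣_∣ (solve 2 (λ a b → a := b :+ (a :- b)) refl (s n) (s N)) ⟩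
    ℚ.∣ s N ℚ.+ (s n ℚ.- s N) ∣
      ≤⟨ ℚ.∣p+q∣≤∣p∣+∣q∣ (s N) (s n ℚ.- s N) ⟩
    ℚ.∣ s N ∣ ℚ.+ ℚ.∣ s n ℚ.- s N ∣
      ≤⟨ ℚ.+-monoʳ-≤ ℚ.∣ s N ∣ (ℚ.<⇒≤ (p n N N≤n ℕ.≤-refl)) ⟩
    ℚ.∣ s N ∣ ℚ.+ 1ℚ ∎
    where
    open +-*-Solver
    open ℚ.≤-Reasoning
    K>0 : 0ℚ ℚ.< ℚ.∣ s N ∣ ℚ.+ 1ℚ
    K>0 = ℚ.+-mono-≤-< (ℚ.0≤∣p∣ (s N)) (ℚ.positive⁻¹ 1ℚ)

  -- For positive K and ε there is δ > 0 with Kδ = ε.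
  divide-pos : ∀ K ε → 0ℚ ℚ.< K → 0ℚ ℚ.< ε → ∃ λ δ → 0ℚ ℚ.< δ × K ℚ.* δ ≡ ε
  divide-pos K ε K>0 ε>0 = δ , δ>0 , eq
    where
    open +-*-Solver
    open ℚ.≤-Reasoning
    instance
      K-positive : ℚ.Positive K
      K-positive = ℚ.positive K>0
      K-nonZero : ℚ.NonZero K
      K-nonZero = ℚ.pos⇒nonZero K
      1/K-positive : ℚ.Positive (ℚ.1/ K)
      1/K-positive = ℚ.1/pos⇒pos K
    δ : ℚ
    δ = ε ℚ.* ℚ.1/ K
    δ>0 : 0ℚ ℚ.< δ
    δ>0 = subst (ℚ._< δ) (ℚ.*-zeroˡ (ℚ.1/ K)) (ℚ.*-monoˡ-<-pos (ℚ.1/ K) ε>0)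
    eq : K ℚ.* δ ≡ ε
    eq = begin-equality
      K ℚ.* (ε ℚ.* ℚ.1/ K)  ≡⟨ solve 3 (λ k e i → k :* (e :* i) := e :* (k :* i)) refl K ε (ℚ.1/ K) ⟩
      ε ℚ.* (K ℚ.* ℚ.1/ K)  ≡⟨ cong (ε ℚ.*_) (ℚ.*-inverseʳ K) ⟩
      ε ℚ.* 1ℚ              ≡⟨ ℚ.*-identityʳ ε ⟩
      ε                     ∎

  *-bound : ∀ {p q K δ} → 0ℚ ℚ.< K → ℚ.∣ p ∣ ℚ.≤ K → ℚ.∣ q ∣ ℚ.< δ → ℚ.∣ p ℚ.* q ∣ ℚ.< K ℚ.* δ
  *-bound {p} {q} {K} {δ} K>0 p≤K q<δ = begin-strict
    ℚ.∣ p ℚ.* q ∣          ≡⟨ ℚ.∣p*q∣≡∣p∣*∣q∣ p q ⟩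
    ℚ.∣ p ∣ ℚ.* ℚ.∣ q ∣    ≤⟨ ℚ.*-monoʳ-≤-nonNeg ℚ.∣ q ∣ {{ℚ.∣-∣-nonNeg q}} p≤K ⟩
    K ℚ.* ℚ.∣ q ∣          <⟨ ℚ.*-monoʳ-<-pos K {{ℚ.positive K>0}} q<δ ⟩
    K ℚ.* δ                ∎
    where open ℚ.≤-Reasoning

  *-close : ∀ {a b c d K L δ η} → 0ℚ ℚ.< K → 0ℚ ℚ.< L →
    ℚ.∣ a ∣ ℚ.≤ K → ℚ.∣ d ∣ ℚ.≤ L → ℚ.∣ b ℚ.- d ∣ ℚ.< δ → ℚ.∣ a ℚ.- c ∣ ℚ.< η →
    ℚ.∣ a ℚ.* b ℚ.- c ℚ.* d ∣ ℚ.< K ℚ.* δ ℚ.+ L ℚ.* η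
  *-close {a} {b} {c} {d} {K} {L} {δ} {η} K>0 L>0 a≤K d≤L b-d<δ a-c<η = begin-strict
    ℚ.∣ a ℚ.* b ℚ.- c ℚ.* d ∣
      ≡⟨ cong ℚ.∣_∣ (solve 4
           (λ a b c d → a :* b :- c :* d := a :* (b :- d) :+ d :* (a :- c))
           refl a b c d) ⟩
    ℚ.∣ a ℚ.* (b ℚ.- d) ℚ.+ d ℚ.* (a ℚ.- c) ∣
      ≤⟨ ℚ.∣p+q∣≤∣p∣+∣q∣ (a ℚ.* (b ℚ.- d)) (d ℚ.* (a ℚ.- c)) ⟩
    ℚ.∣ a ℚ.* (b ℚ.- d) ∣ ℚ.+ ℚ.∣ d ℚ.* (a ℚ.- c) ∣
      <⟨ ℚ.+-mono-< (*-bound {a} {b ℚ.- d} K>0 a≤K b-d<δ)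
                    (*-bound {d} {a ℚ.- c} L>0 d≤L a-c<η) ⟩
    K ℚ.* δ ℚ.+ L ℚ.* η ∎
    where
    open +-*-Solver
    open ℚ.≤-Reasoning

  *-cauchy : ∀ {s t} → IsCauchy s → IsCauchy t → IsCauchy (λ n → s n ℚ.* t n)
  *-cauchy {s} {t} cs ct ε ε>0 =
    let K , K>0 , M₁ , s≤K = cauchy-bounded cs
        L , L>0 , M₂ , t≤L = cauchy-bounded ct
        δ , δ>0 , Kδ≡ε/2   = divide-pos K (ε ℚ.* ½) K>0 (halve-pos ε ε>0)
        η , η>0 , Lη≡ε/2   = divide-pos L (ε ℚ.* ½) L>0 (halve-pos ε ε>0)
    in combine K L δ η K>0 L>0 Kδ≡ε/2 Lη≡ε/2 (M₁ , s≤K) (M₂ , t≤L) (ct δ δ>0) (cs η η>0)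
    where
    combine : ∀ K L δ η → 0ℚ ℚ.< K → 0ℚ ℚ.< L →
      K ℚ.* δ ≡ ε ℚ.* ½ → L ℚ.* η ≡ ε ℚ.* ½ →
      Eventually (λ n → ℚ.∣ s n ∣ ℚ.≤ K) → Eventually (λ n → ℚ.∣ t n ∣ ℚ.≤ L) →
      (∃ λ N → ∀ m n → N ℕ.≤ m → N ℕ.≤ n → ℚ.∣ t m ℚ.- t n ∣ ℚ.< δ) →
      (∃ λ N → ∀ m n → N ℕ.≤ m → N ℕ.≤ n → ℚ.∣ s m ℚ.- s n ∣ ℚ.< η) →
      ∃ λ N → ∀ m n → N ℕ.≤ m → N ℕ.≤ n → ℚ.∣ s m ℚ.* t m ℚ.- s n ℚ.* t n ∣ ℚ.< ε
    combine K L δ η K>0 L>0 Kδ≡ε/2 Lη≡ε/2 (M₁ , s≤K) (M₂ , t≤L) (N₁ , t-close) (N₂ , s-close) =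
      M ℕ.⊔ N , λ m n M⊔N≤m M⊔N≤n →
        let M≤m = ℕ.m⊔n≤o⇒m≤o M N M⊔N≤m
            M≤n = ℕ.m⊔n≤o⇒m≤o M N M⊔N≤n
            N≤m = ℕ.m⊔n≤o⇒n≤o M N M⊔N≤m
            N≤n = ℕ.m⊔n≤o⇒n≤o M N M⊔N≤n
        in subst (ℚ.∣ s m ℚ.* t m ℚ.- s n ℚ.* t n ∣ ℚ.<_) total
             (*-close {s m} {t m} {s n} {t n} K>0 L>0
               (s≤K m (ℕ.m⊔n≤o⇒m≤o M₁ M₂ M≤m))
               (t≤L n (ℕ.m⊔n≤o⇒n≤o M₁ M₂ M≤n))
               (t-close m n (ℕ.m⊔n≤o⇒m≤o N₁ N₂ N≤m) (ℕ.m⊔n≤o⇒m≤o N₁ N₂ N≤n))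
               (s-close m n (ℕ.m⊔n≤o⇒n≤o N₁ N₂ N≤m) (ℕ.m⊔n≤o⇒n≤o N₁ N₂ N≤n)))
      where
      M N : ℕ
      M = M₁ ℕ.⊔ M₂
      N = N₁ ℕ.⊔ N₂
      total : K ℚ.* δ ℚ.+ L ℚ.* η ≡ ε
      total = begin
        K ℚ.* δ ℚ.+ L ℚ.* η    ≡⟨ cong₂ ℚ._+_ Kδ≡ε/2 Lη≡ε/2 ⟩
        ε ℚ.* ½ ℚ.+ ε ℚ.* ½    ≡⟨ halves ε ⟩
        ε                      ∎
        where open Relation.Binary.PropositionalEquality.≡-Reasoning

infixl 6 _+_ _-_
infixl 7 _*_
infixr 8 _^_
infix  8 -_

fromℚ : ℚ → ℝ
fromℚ q = mkℝ (λ _ → q) (const-cauchy q)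

0ℝ 1ℝ : ℝ
0ℝ = fromℚ 0ℚ
1ℝ = fromℚ 1ℚ

_+_ _*_ : ℝ → ℝ → ℝ
x + y = mkℝ (λ n → seq x n ℚ.+ seq y n) (+-cauchy {seq x} {seq y} (cauchy x) (cauchy y))
x * y = mkℝ (λ n → seq x n ℚ.* seq y n) (*-cauchy {seq x} {seq y} (cauchy x) (cauchy y))

-_ ∣_∣ : ℝ → ℝ
- x   = mkℝ (λ n → ℚ.- seq x n) (neg-cauchy {seq x} (cauchy x))
∣ x ∣ = mkℝ (λ n → ℚ.∣ seq x n ∣) (abs-cauchy {seq x} (cauchy x))

_-_ : ℝ → ℝ → ℝ
x - y = x + - y

_^_ : ℝ → ℕ → ℝ
x ^ zero  = 1ℝ
x ^ suc n = x * x ^ n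

------------------------------------------------------------------------
-- ℝᵈ and its norms

infix  4 _≈ᵥ_
infixl 6 _+ᵥ_ _-ᵥ_
infixl 7 _*ᵥ_

ℝ^_ : ℕ → Set
ℝ^ d = Vector ℝ d

_≈ᵥ_ : ∀ {d} → ℝ^ d → ℝ^ d → Set
_≈ᵥ_ = Pointwise _≈_

0ᵥ : ∀ {d} → ℝ^ d
0ᵥ = replicate _ 0ℝ

_+ᵥ_ _-ᵥ_ : ∀ {d} → ℝ^ d → ℝ^ d → ℝ^ d
_+ᵥ_ = zipWith _+_
_-ᵥ_ = zipWith _-_

_*ᵥ_ : ∀ {d} → ℝ → ℝ^ d → ℝ^ d
t *ᵥ v = map (t *_) v

record Norm (d : ℕ) : Set where
  field
    ‖_‖         : ℝ^ d → ℝ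
    ‖‖-cong     : ∀ {u v} → u ≈ᵥ v → ‖ u ‖ ≈ ‖ v ‖
    nonNegative : ∀ v → 0ℝ ≤ ‖ v ‖
    definite    : ∀ v → ‖ v ‖ ≈ 0ℝ → v ≈ᵥ 0ᵥ
    homogeneous : ∀ t v → ‖ t *ᵥ v ‖ ≈ ∣ t ∣ * ‖ v ‖
    triangle    : ∀ u v → ‖ u +ᵥ v ‖ ≤ ‖ u ‖ + ‖ v ‖

------------------------------------------------------------------------
-- Closed balls. A ball is given by its centre and radius; as a subset of ℝᵈ
-- with d ≥ 1 it determines both.

record Ball (d : ℕ) : Set where
  field
    centre   : ℝ^ d
    ρ        : ℝ
    positive : 0ℝ < ρ

open Ball public

infix 4 _≈ᵇ_

_≈ᵇ_ : ∀ {d} → Ball d → Ball d → Set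
B ≈ᵇ B′ = centre B ≈ᵥ centre B′ × ρ B ≈ ρ B′

points : ∀ {d} → Norm d → Ball d → Pred (ℝ^ d) 0ℓ
points norm B x = ‖ x -ᵥ centre B ‖ ≤ ρ B
  where open Norm norm

-- The collection written B^γ.
SubBalls : ∀ {d} → Norm d → ℝ → Ball d → Pred (Ball d) 0ℓ
SubBalls norm γ B B̃ = points norm B̃ ⊆ points norm B × ρ B̃ ≈ γ * ρ B

------------------------------------------------------------------------
-- The (α,β)-game. Rounds are counted from 0: in round n Bob has chosen
-- B₀,…,Bₙ, Alice has chosen A₀,…,Aₙ₋₁, and Alice is to choose Aₙ.

module Game {d : ℕ} (norm : Norm d) (α β : ℝ) where

  record Position (n : ℕ) : Set where
    field
      bob         : Vector (Ball d) (suc n)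
      alice       : Vector (Ball d) n
      alice-legal : ∀ i → alice i ∈ SubBalls norm α (bob (inject₁ i))
      bob-legal   : ∀ i → bob (fsuc i) ∈ SubBalls norm β (alice i)

  open Position

  _≈ᵖ_ : ∀ {n} → Position n → Position n → Set
  p ≈ᵖ q = Pointwise _≈ᵇ_ (bob p) (bob q) × Pointwise _≈ᵇ_ (alice p) (alice q)

  -- move-cong makes the move a function of the balls played, not of the
  -- sequences of rationals representing them or of the legality proofs.
  record Strategy : Set where
    field
      move       : ∀ {n} → Position n → Ball d
      move-legal : ∀ {n} (p : Position n) → move p ∈ SubBalls norm α (bob p (fromℕ n))
      move-cong  : ∀ {n} {p q : Position n} → p ≈ᵖ q → move p ≈ᵇ move q

  record Play : Set where
    field
      bobs         : ℕ → Ball d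
      alices       : ℕ → Ball d
      alices-legal : ∀ n → alices n ∈ SubBalls norm α (bobs n)
      bobs-legal   : ∀ n → bobs (suc n) ∈ SubBalls norm β (alices n)

  open Play

  positionAt : Play → ∀ n → Position n
  positionAt π n = record
    { bob         = λ i → bobs π (toℕ i)
    ; alice       = λ i → alices π (toℕ i)
    ; alice-legal = λ i →
        subst (λ k → alices π (toℕ i) ∈ SubBalls norm α (bobs π k))
              (sym (toℕ-inject₁ i)) (alices-legal π (toℕ i))
    ; bob-legal   = λ i → bobs-legal π (toℕ i)
    }

  Follows : Strategy → Play → Set
  Follows σ π = ∀ n → alices π n ≈ᵇ Strategy.move σ (positionAt π n)

  -- The outcome is quantified as any point common to all of Bob's balls; for
  -- 0 < α, β < 1 there is exactly one.
  Winning : ∀ {ℓ} → Pred (ℝ^ d) ℓ → Set ℓ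
  Winning S = Σ[ σ ∈ Strategy ] (∀ π → Follows σ π →
    ∀ x → (∀ n → x ∈ points norm (bobs π n)) → x ∈ S)

{-# OPTIONS --safe #-}

-- Alice plays N games at once: in round i + j N, with i < N, she answers with the strategy
-- for Sᵢ, which sees only the rounds congruent to i modulo N. Between two such
-- rounds the radius of Alice's ball is multiplied by β (α β)ᴺ⁻¹ to give the
-- radius of Bob's, and the balls are nested, so this is a play of the
-- (α, β (α β)ᴺ⁻¹)-game, and it has the same outcome.
module Submission where

open import Data.Fin.Base
  using (Fin; toℕ; fromℕ; fromℕ<)
open import Data.Fin.Properties
  using (toℕ<n; toℕ-fromℕ; toℕ-fromℕ<; toℕ-inject₁; toℕ-injective)
open import Data.Nat.Base as ℕ using (ℕ; zero; suc; NonZero; _∸_)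
open import Data.Nat.DivMod
  using (DivMod; _divMod_; [m+kn]%n≡m%n; m<n⇒m%n≡m)
import Data.Nat.Properties as ℕ
open import Algebra.Properties.CommutativeSemigroup ℕ.+-commutativeSemigroup
  using (x∙yz≈y∙xz)
open import Data.Product.Base using (_×_; _,_; proj₁; proj₂)
open import Data.Rational.Base as ℚ using (½)
import Data.Rational.Properties as ℚ
open import Data.Rational.Solver using (module +-*-Solver)
open import Function.Base using (_∘_)
open import Level using (Level)
open import Relation.Binary.Definitions using (_Respects_)
open import Relation.Binary.PropositionalEquality
  using (_≡_; refl; sym; trans; cong; subst; subst₂; module ≡-Reasoning)
open import Relation.Unary using (Pred; ⋂; _∈_)
open import Defs

-- Equality of reals and of balls.

≗⇒≈ : ∀ {x y} → (∀ n → seq x n ≡ seq y n) → x ≈ y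
≗⇒≈ {x} {y} eq ε ε>0 = 0 , λ n _ → subst (ℚ._< ε) (sym (distance n)) ε>0
  where
  open ≡-Reasoning
  distance : ∀ n → ℚ.∣ seq x n ℚ.- seq y n ∣ ≡ ℚ.0ℚ
  distance n = begin
    ℚ.∣ seq x n ℚ.- seq y n ∣  ≡⟨ cong (λ q → ℚ.∣ q ℚ.- seq y n ∣) (eq n) ⟩
    ℚ.∣ seq y n ℚ.- seq y n ∣  ≡⟨ cong ℚ.∣_∣ (ℚ.+-inverseʳ (seq y n)) ⟩
    ℚ.0ℚ                       ∎

≈-refl : ∀ {x} → x ≈ x
≈-refl {x} = ≗⇒≈ {x} {x} (λ _ → refl)

≈-trans : ∀ {x y z} → x ≈ y → y ≈ z → x ≈ z
≈-trans {x} {y} {z} x≈y y≈z ε ε>0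
  with x≈y (ε ℚ.* ½) (halve-pos ε ε>0) | y≈z (ε ℚ.* ½) (halve-pos ε ε>0)
... | M , x-y | N , y-z = M ℕ.⊔ N , λ n M⊔N≤n → begin-strict
  ℚ.∣ seq x n ℚ.- seq z n ∣
    ≡⟨ cong ℚ.∣_∣ (solve 3 (λ a b c → a :- c := (a :- b) :+ (b :- c)) refl
         (seq x n) (seq y n) (seq z n)) ⟩
  ℚ.∣ seq x n ℚ.- seq y n ℚ.+ (seq y n ℚ.- seq z n) ∣
    ≤⟨ ℚ.∣p+q∣≤∣p∣+∣q∣ (seq x n ℚ.- seq y n) (seq y n ℚ.- seq z n) ⟩
  ℚ.∣ seq x n ℚ.- seq y n ∣ ℚ.+ ℚ.∣ seq y n ℚ.- seq z n ∣
    <⟨ ℚ.+-mono-< (x-y n (ℕ.m⊔n≤o⇒m≤o M N M⊔N≤n))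
                  (y-z n (ℕ.m⊔n≤o⇒n≤o M N M⊔N≤n)) ⟩
  ε ℚ.* ½ ℚ.+ ε ℚ.* ½
    ≡⟨ halves ε ⟩
  ε ∎
  where
  open +-*-Solver
  open ℚ.≤-Reasoning

-- The sequence of `c` is eventually bounded by some `K`, so it is enough that `x` and `y` are
-- within ε / `K` of each other.
*-congˡ : ∀ {c x y} → x ≈ y → c * x ≈ c * y
*-congˡ {c} {x} {y} x≈y ε ε>0 with cauchy-bounded (cauchy c)
... | K , K>0 , M , c≤K with divide-pos K ε K>0 ε>0
...   | δ , δ>0 , Kδ≡ε with x≈y δ δ>0
...     | N , x-y = M ℕ.⊔ N , λ n M⊔N≤n →
  subst₂ ℚ._<_ (cong ℚ.∣_∣ (factor (seq c n) (seq x n) (seq y n))) Kδ≡ε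
    (*-bound {seq c n} {seq x n ℚ.- seq y n} K>0
      (c≤K n (ℕ.m⊔n≤o⇒m≤o M N M⊔N≤n)) (x-y n (ℕ.m⊔n≤o⇒n≤o M N M⊔N≤n)))
  where
  open +-*-Solver
  factor : ∀ c x y → c ℚ.* (x ℚ.- y) ≡ c ℚ.* x ℚ.- c ℚ.* y
  factor = solve 3 (λ c x y → c :* (x :- y) := c :* x :- c :* y) refl

≡⇒≈ᵇ : ∀ {d} {B B′ : Ball d} → B ≡ B′ → B ≈ᵇ B′
≡⇒≈ᵇ {B = B} refl = (λ i → ≈-refl {centre B i}) , ≈-refl {ρ B}

≈ᵇ-trans : ∀ {d} {B C D : Ball d} → B ≈ᵇ C → C ≈ᵇ D → B ≈ᵇ D
≈ᵇ-trans {B = B} {C} {D} (c , r) (c′ , r′) =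
  (λ i → ≈-trans {centre B i} {centre C i} {centre D i} (c i) (c′ i)) ,
  ≈-trans {ρ B} {ρ C} {ρ D} r r′

-- Radius ratios along chains of nested balls.

SubBalls-trans : ∀ {d} (norm : Norm d) {γ δ} {B C D : Ball d} →
  C ∈ SubBalls norm γ B → D ∈ SubBalls norm δ C → D ∈ SubBalls norm (δ * γ) B
SubBalls-trans norm {γ} {δ} {B} {C} {D} (C⊆B , ρC) (D⊆C , ρD) =
  (λ {x} x∈D → C⊆B {x} (D⊆C {x} x∈D)) ,
  ≈-trans {ρ D} {δ * ρ C} {δ * γ * ρ B} ρD
    (≈-trans {δ * ρ C} {δ * (γ * ρ B)} {δ * γ * ρ B}
      (*-congˡ {δ} {ρ C} {γ * ρ B} ρC)
      (≗⇒≈ {δ * (γ * ρ B)} {δ * γ * ρ B}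
        (λ n → sym (ℚ.*-assoc (seq δ n) (seq γ n) (seq (ρ B) n)))))

-- Termwise equality is enough here: the ratios compared below differ by ring identities, and the
-- operations on reals act termwise on sequences.
SubBalls-resp : ∀ {d} (norm : Norm d) {γ δ} {B C : Ball d} →
  (∀ n → seq γ n ≡ seq δ n) → C ∈ SubBalls norm γ B → C ∈ SubBalls norm δ B
SubBalls-resp norm {γ} {δ} {B} {C} γ≗δ (C⊆B , ρC) =
  C⊆B ,
  ≈-trans {ρ C} {γ * ρ B} {δ * ρ B} ρC
    (≗⇒≈ {γ * ρ B} {δ * ρ B} (λ n → cong (ℚ._* seq (ρ B) n) (γ≗δ n)))

module _ {d : ℕ} (norm : Norm d) (α β : ℝ) where

  -- The ratio from a ball of Alice to Bob's ball `m + 1` rounds later: Bob's own reply gives β, and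
  -- each of the `m` further rounds gives α β.
  delayed-ratio : ℕ → ℝ
  delayed-ratio m = β * (α * β) ^ m

  delayed-zero : ∀ {A B} → B ∈ SubBalls norm β A →
    B ∈ SubBalls norm (delayed-ratio 0) A
  delayed-zero {A} {B} = SubBalls-resp norm {β} {delayed-ratio 0} {A} {B}
    (λ n → sym (ℚ.*-identityʳ (seq β n)))

  delayed-suc : ∀ {m A B A′ B′} →
    B ∈ SubBalls norm (delayed-ratio m) A →
    A′ ∈ SubBalls norm α B → B′ ∈ SubBalls norm β A′ →
    B′ ∈ SubBalls norm (delayed-ratio (suc m)) A
  delayed-suc {m} {A} {B} {A′} {B′} B∈ A′∈ B′∈ =
    SubBalls-resp norm {β * (α * delayed-ratio m)} {delayed-ratio (suc m)} {A} {B′}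
      -- `SubBalls-trans` puts each new factor in front, so the product must be rebracketed to
      -- expose the next power of α β.
      (λ n → regroup (seq α n) (seq β n) (seq ((α * β) ^ m) n))
      (SubBalls-trans norm {α * delayed-ratio m} {β} {A} {A′} {B′}
        (SubBalls-trans norm {delayed-ratio m} {α} {A} {B} {A′} B∈ A′∈) B′∈)
    where
    open +-*-Solver
    regroup : ∀ a b p → b ℚ.* (a ℚ.* (b ℚ.* p)) ≡ b ℚ.* (a ℚ.* b ℚ.* p)
    regroup = solve 3 (λ a b p → b :* (a :* (b :* p)) := b :* (a :* b :* p)) refl

-- Rounds of the interleaved games.

module Interleaving {d : ℕ} (norm : Norm d) (α β : ℝ) (M : ℕ) where

  N : ℕ
  N = suc M

  -- Consecutive rounds of a subgame are `N` apart, so `M` rounds of other subgames lie between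
  -- them.
  γ : ℝ
  γ = delayed-ratio norm α β M

  module G = Game norm α β
  module H = Game norm α γ

  open G.Position
  open G.Play

  -- The round of G in which round j of the i-th subgame is played, defined by
  -- recursion so that bobAt-delayed and bobs-delayed apply without transport.
  round : ℕ → ℕ → ℕ
  round i zero    = i
  round i (suc j) = suc (M ℕ.+ round i j)

  round≡ : ∀ i j → round i j ≡ i ℕ.+ j ℕ.* N
  round≡ i zero    = sym (ℕ.+-identityʳ i)
  round≡ i (suc j) = trans (cong (N ℕ.+_) (round≡ i j)) (x∙yz≈y∙xz N i (j ℕ.* N))

  round-mono-≤ : ∀ i {j k} → j ℕ.≤ k → round i j ℕ.≤ round i k
  round-mono-≤ i {j} {k} j≤k = subst₂ ℕ._≤_ (sym (round≡ i j)) (sym (round≡ i k))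
    (ℕ.+-monoʳ-≤ i (ℕ.*-monoˡ-≤ N j≤k))

  round-mono-< : ∀ i {j k} → j ℕ.< k → round i j ℕ.< round i k
  round-mono-< i {j} {k} j<k = subst₂ ℕ._<_ (sym (round≡ i j)) (sym (round≡ i k))
    (ℕ.+-monoʳ-< i (ℕ.*-monoˡ-< N j<k))

  -- Positions of the subgames.

  module _ {n : ℕ} (p : G.Position n) where

    -- Indexing by round number suits arithmetic on rounds; since the bound is irrelevant, different
    -- proofs of it give the same ball definitionally.
    bobAt : ∀ m → .(m ℕ.≤ n) → Ball d
    bobAt m m≤n = bob p (fromℕ< (ℕ.s≤s m≤n))

    aliceAt : ∀ m → .(m ℕ.< n) → Ball d
    aliceAt m m<n = alice p (fromℕ< m<n)

    aliceAt-legal : ∀ m (m<n : m ℕ.< n) →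
      aliceAt m m<n ∈ SubBalls norm α (bobAt m (ℕ.<⇒≤ m<n))
    aliceAt-legal m m<n =
      subst (λ i → aliceAt m m<n ∈ SubBalls norm α (bob p i))
        (toℕ-injective (trans (toℕ-inject₁ _)
          (trans (toℕ-fromℕ< m<n) (sym (toℕ-fromℕ< (ℕ.s≤s (ℕ.<⇒≤ m<n)))))))
        (alice-legal p (fromℕ< m<n))

    -- Induction on `m`, adding one answer of Alice and one of Bob. Only the legality of the moves
    -- in between matters, not the strategies behind them; `m = M` makes Bob's moves legal in a
    -- subgame.
    bobAt-delayed : ∀ m a (h : suc (m ℕ.+ a) ℕ.≤ n) (a<n : a ℕ.< n) →
      bobAt (suc (m ℕ.+ a)) h ∈ SubBalls norm (delayed-ratio norm α β m) (aliceAt a a<n)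
    bobAt-delayed zero a h a<n =
      delayed-zero norm α β {aliceAt a a<n} {bobAt (suc a) h} (bob-legal p (fromℕ< h))
    bobAt-delayed (suc m) a h a<n =
      delayed-suc norm α β {m} {aliceAt a a<n} {bobAt (suc (m ℕ.+ a)) h′}
        {aliceAt (suc (m ℕ.+ a)) h} {bobAt (suc (suc (m ℕ.+ a))) h}
        (bobAt-delayed m a h′ a<n)
        (aliceAt-legal (suc (m ℕ.+ a)) h)
        (bob-legal p (fromℕ< h))
      where
      h′ : suc (m ℕ.+ a) ℕ.≤ n
      h′ = ℕ.<⇒≤ h

    module _ (i k : ℕ) (n≡ : n ≡ round i k) where

      round≤n : ∀ {j} → j ℕ.≤ k → round i j ℕ.≤ n
      round≤n j≤k = ℕ.≤-trans (round-mono-≤ i j≤k) (ℕ.≤-reflexive (sym n≡))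

      round<n : ∀ {j} → j ℕ.< k → round i j ℕ.< n
      round<n j<k = ℕ.<-≤-trans (round-mono-< i j<k) (ℕ.≤-reflexive (sym n≡))

      -- Rounds before `i` are dropped: Bob's ball of round `i` becomes his opening move, which may
      -- be any ball.
      subPosition : H.Position k
      subPosition = record
        { bob         = λ j → bobAt (round i (toℕ j)) (round≤n (ℕ.s≤s⁻¹ (toℕ<n j)))
        ; alice       = λ j → aliceAt (round i (toℕ j)) (round<n (toℕ<n j))
        ; alice-legal = λ j →
            subst (_∈_ (aliceAt (round i (toℕ j)) (round<n (toℕ<n j))) ∘ SubBalls norm α)
              (cong (bob p) (toℕ-injective (trans (toℕ-fromℕ< _)
                (trans (cong (round i) (sym (toℕ-inject₁ j))) (sym (toℕ-fromℕ< _))))))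
              (aliceAt-legal (round i (toℕ j)) (round<n (toℕ<n j)))
        ; bob-legal   = λ j →
            bobAt-delayed M (round i (toℕ j)) (round≤n {suc (toℕ j)} (toℕ<n j)) (round<n (toℕ<n j))
        }

      -- Alice answers the same ball with the same ratio α in both games, so a legal reply in the
      -- subgame is legal in the whole game.
      subPosition-last : H.Position.bob subPosition (fromℕ k) ≡ bob p (fromℕ n)
      subPosition-last = cong (bob p) (toℕ-injective (begin
        toℕ (fromℕ< _)           ≡⟨ toℕ-fromℕ< _ ⟩
        round i (toℕ (fromℕ k))  ≡⟨ cong (round i) (toℕ-fromℕ k) ⟩
        round i k                ≡⟨ n≡ ⟨
        n                        ≡⟨ toℕ-fromℕ n ⟨
        toℕ (fromℕ n)            ∎))
        where open ≡-Reasoning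

  subPosition-cong : ∀ {n} {p q : G.Position n} i k (n≡ : n ≡ round i k) →
    p G.≈ᵖ q → subPosition p i k n≡ H.≈ᵖ subPosition q i k n≡
  subPosition-cong i k n≡ (bob≈ , alice≈) = (λ _ → bob≈ _) , (λ _ → alice≈ _)

  -- Infinite plays of the subgames.

  module _ (π : G.Play) where

    bobs-delayed : ∀ m a →
      bobs π (suc (m ℕ.+ a)) ∈ SubBalls norm (delayed-ratio norm α β m) (alices π a)
    bobs-delayed zero a =
      delayed-zero norm α β {alices π a} {bobs π (suc a)} (bobs-legal π a)
    bobs-delayed (suc m) a =
      delayed-suc norm α β {m} {alices π a} {bobs π (suc (m ℕ.+ a))}
        {alices π (suc (m ℕ.+ a))} {bobs π (suc (suc (m ℕ.+ a)))}
        (bobs-delayed m a)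
        (alices-legal π (suc (m ℕ.+ a)))
        (bobs-legal π (suc (m ℕ.+ a)))

    subPlay : ℕ → H.Play
    subPlay i = record
      { bobs         = bobs π ∘ round i
      ; alices       = alices π ∘ round i
      ; alices-legal = alices-legal π ∘ round i
      ; bobs-legal   = λ j → bobs-delayed M (round i j)
      }

    -- Both sides select the same balls of `π`; they differ only in index expressions and legality
    -- proofs, which `≈ᵖ` does not see.
    subPosition-positionAt : ∀ {n} i k (n≡ : n ≡ round i k) →
      subPosition (G.positionAt π n) i k n≡ H.≈ᵖ H.positionAt (subPlay i) k
    subPosition-positionAt i k n≡ =
      (λ j → ≡⇒≈ᵇ (cong (bobs π) (toℕ-fromℕ< _))) ,
      (λ j → ≡⇒≈ᵇ (cong (alices π) (toℕ-fromℕ< _)))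

  -- Recovering the subgame from the round.

  -- Uniqueness of division by `N`: the remainder determines the subgame, and cancellation then
  -- gives its round.
  round-toℕ-injective : ∀ {i i′ : Fin N} {j j′} →
    round (toℕ i) j ≡ round (toℕ i′) j′ → i ≡ i′ × j ≡ j′
  round-toℕ-injective {i} {i′} {j} {j′} eq = toℕ-injective i≡i′ ,
    ℕ.*-cancelʳ-≡ j j′ N (ℕ.+-cancelˡ-≡ (toℕ i) _ _ (begin
      toℕ i ℕ.+ j ℕ.* N    ≡⟨ round≡ (toℕ i) j ⟨
      round (toℕ i) j      ≡⟨ eq ⟩
      round (toℕ i′) j′    ≡⟨ round≡ (toℕ i′) j′ ⟩
      toℕ i′ ℕ.+ j′ ℕ.* N  ≡⟨ cong (ℕ._+ j′ ℕ.* N) i≡i′ ⟨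
      toℕ i ℕ.+ j′ ℕ.* N   ∎))
    where
    open ≡-Reasoning
    round-% : ∀ (i : Fin N) j → round (toℕ i) j ℕ.% N ≡ toℕ i
    round-% i j = begin
      round (toℕ i) j ℕ.% N      ≡⟨ cong (ℕ._% N) (round≡ (toℕ i) j) ⟩
      (toℕ i ℕ.+ j ℕ.* N) ℕ.% N  ≡⟨ [m+kn]%n≡m%n (toℕ i) j N ⟩
      toℕ i ℕ.% N                ≡⟨ m<n⇒m%n≡m (toℕ<n i) ⟩
      toℕ i                      ∎
    i≡i′ : toℕ i ≡ toℕ i′
    i≡i′ = trans (sym (round-% i j)) (trans (cong (ℕ._% N) eq) (round-% i′ j′))

  game : ℕ → Fin N
  game n = DivMod.remainder (n divMod N)

  gameRound : ℕ → ℕ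
  gameRound n = DivMod.quotient (n divMod N)

  n≡round : ∀ n → n ≡ round (toℕ (game n)) (gameRound n)
  n≡round n = trans (DivMod.property (n divMod N))
    (sym (round≡ (toℕ (game n)) (gameRound n)))

  -- The combined strategy.

  module _ (σ : Fin N → H.Strategy) where

    open H.Strategy

    interleave : G.Strategy
    interleave = record
      { move       = λ {n} p →
          move (σ (game n)) (subPosition p (toℕ (game n)) (gameRound n) (n≡round n))
      ; move-legal = λ {n} p →
          let p′ = subPosition p (toℕ (game n)) (gameRound n) (n≡round n)
          in subst (_∈_ (move (σ (game n)) p′) ∘ SubBalls norm α)
               (subPosition-last p (toℕ (game n)) (gameRound n) (n≡round n))
               (move-legal (σ (game n)) p′)
      ; move-cong  = λ {n} {p} {q} p≈q →
          move-cong (σ (game n))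
            (subPosition-cong {p = p} {q} (toℕ (game n)) (gameRound n) (n≡round n) p≈q)
      }

    -- In round `round (toℕ i) j` the combined strategy consults subgame `i` at its round `j`, by
    -- uniqueness of division, and there it sees the position of the subplay up to `≈ᵖ`.
    subPlay-follows : ∀ π → G.Follows interleave π →
      ∀ i → H.Follows (σ i) (subPlay π (toℕ i))
    subPlay-follows π follows i j =
      ≈ᵇ-trans {B = alices π n} {G.Strategy.move interleave (G.positionAt π n)}
        {move (σ i) (H.positionAt (subPlay π (toℕ i)) j)}
        (follows n)
        (move-in-subgame (game n) (gameRound n) (n≡round n)
          (round-toℕ-injective (sym (n≡round n))))
      where
      n : ℕ
      n = round (toℕ i) j
      -- Replacing `game n` and `gameRound n` by variables allows matching their equalities with
      -- `refl`.
      move-in-subgame : ∀ i′ j′ (n≡ : n ≡ round (toℕ i′) j′) → i′ ≡ i × j′ ≡ j →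
        move (σ i′) (subPosition (G.positionAt π n) (toℕ i′) j′ n≡)
          ≈ᵇ move (σ i) (H.positionAt (subPlay π (toℕ i)) j)
      move-in-subgame i′ j′ n≡ (refl , refl) =
        move-cong (σ i) (subPosition-positionAt π (toℕ i) j n≡)

theorem7p2 : {ℓ : Level} (d N : ℕ) .{{_ : NonZero d}} .{{_ : NonZero N}}
    (norm : Norm d) (α β : ℝ) →
    0ℝ < α → α < 1ℝ → 0ℝ < β → β < 1ℝ →
    (S : Fin N → Pred (ℝ^ d) ℓ) → (∀ i → (S i) Respects _≈ᵥ_) →
    (∀ i → Game.Winning norm α (β * (α * β) ^ (N ∸ 1)) (S i)) →
    Game.Winning norm α β (⋂ (Fin N) S)
theorem7p2 d (suc M) norm α β _ _ _ _ S _ winning =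
  interleave σ , λ π follows x x∈bobs i →
    -- A point common to all of Bob's balls is common to those of each subplay.
    proj₂ (winning i) (subPlay π (toℕ i)) (subPlay-follows σ π follows i)
      x (λ j → x∈bobs (round (toℕ i) j))
  where
  -- `suc M ∸ 1` computes to `M`, so `winning` already concerns the game with ratio `γ`.
  open Interleaving norm α β M
  σ : Fin (suc M) → H.Strategy
  σ i = proj₁ (winning i)
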